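{- For every $K_5$-free finite simple graph $G$ on $n$ vertices, $\tau_{B}(G) \le \frac{29 n^2}{200}$.
   Context: All graphs are finite, simple and undirected. $\tau_{B}(G)$ denotes the minimum size of a set of edges whose deletion from $G$ leaves a bipartite graph. $K_5$-free means $G$ contains no complete subgraph on $5$ vertices. -}

module Defs where

open import Data.Nat using (ℕ; _*_; _≤_; _<_)
open import Data.Bool using (Bool; true; false; T; _∧_)
open import Data.Fin using (Fin; toℕ)
open import Data.Fin.Properties using ()
open import Data.List using (List; length; filter; allFin; concatMap; map)
open import Data.Product using (Σ; ∃; _×_; _,_; proj₁; proj₂)
open import Relation.Binary.PropositionalEquality using (_≡_; _≢_)
open import Relation.Nullary using (¬_)
open import Relation.Nullary.Decidable using (Dec)
open import Function.Definitions using (Injective)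

record Graph (n : ℕ) : Set where
  field
    adj   : Fin n → Fin n → Bool
    sym   : ∀ u v → adj u v ≡ adj v u
    irrefl : ∀ v → adj v v ≡ false
open Graph public

K5-free : ∀ {n} → Graph n → Set
K5-free {n} G =
  ¬ (Σ (Fin 5 → Fin n) λ f →
       Injective _≡_ _≡_ f × (∀ i j → i ≢ j → T (adj G (f i) (f j))))

pairs : (n : ℕ) → List (Fin n × Fin n)
pairs n = concatMap (λ u → map (λ v → (u , v)) (allFin n)) (allFin n)

record EdgeSubset {n} (G : Graph n) : Set where
  field
    mem    : Fin n → Fin n → Bool
    memSym : ∀ u v → mem u v ≡ mem v u
    memSub : ∀ u v → T (mem u v) → T (adj G u v)
open EdgeSubset public

-- number of edges in F (each unordered edge {u,v} counted once, via u < v)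
size : ∀ {n} {G : Graph n} → EdgeSubset G → ℕ
size {n} F =
  length (filter (λ p → Data.Nat._<?_ (toℕ (proj₁ p)) (toℕ (proj₂ p))
                         Relation.Nullary.Decidable.×-dec
                         Data.Bool._≟_ (mem F (proj₁ p) (proj₂ p)) true)
                 (pairs n))
  where import Data.Nat
        import Data.Bool
        import Relation.Nullary.Decidable

BipartiteAfterDeleting : ∀ {n} (G : Graph n) → EdgeSubset G → Set
BipartiteAfterDeleting {n} G F =
  Σ (Fin n → Bool) λ c →
    ∀ u v → T (adj G u v) → ¬ T (mem F u v) → c u ≢ c v

-- τ_B(G) ≤ k : there is an edge set of size at most k whose deletion leaves
-- a bipartite graph (τ_B(G) is the minimum such size).
τB≤ : ∀ {n} → Graph n → ℕ → Set
τB≤ G k = Σ (EdgeSubset G) λ F → BipartiteAfterDeleting G F × size F ≤ k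

-- Real-valued bound without reals: 200·τ_B(G) ≤ 29 n², i.e.
-- ∃ F deleting to bipartite with 200·|F| ≤ 29·n².
τB-scaled≤ : ∀ {n} → Graph n → (num den : ℕ) → Set
τB-scaled≤ G num den =
  Σ (EdgeSubset G) λ F → BipartiteAfterDeleting G F × den * size F ≤ num

{-# OPTIONS --safe #-}
-- A flag-algebra argument on five vertices.  Suppose every 2-colouring leaves too many
-- monochromatic edges.  Then so does every assignment of spins in {-1, 0, 1} (0 standing for
-- a fair coin), because the number of monochromatic edges is affine in each single spin.
-- Apply this to the constant assignment 0 and, for every triangle abc, to an assignment in
-- which the spin of a vertex depends only on its adjacencies to a, b and c.  A positive
-- combination of the resulting inequalities and of squares of sums over vertices is a
-- non-negative sum over all 5-tuples of vertices; but over the 120 orderings of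
-- any 5-tuple that does not span a K5 its terms add up to a negative number.
module Submission where

open import Defs
import Algebra.Properties.Semiring.Sum
open import Data.Bool.Base using (Bool; true; false; T; not; _∧_; _xor_; if_then_else_)
open import Data.Bool.Properties using (T-≡; xor-comm; xor-same) renaming (_≟_ to _≟ᵇ_)
open import Data.Fin.Base using (Fin; zero; suc; toℕ)
open import Data.Fin.Properties using (all?) renaming (_≟_ to _≟ᶠ_)
open import Data.Fin.Subset.Properties using (anySubset?)
open import Data.Integer.Base using (ℤ; +_; -_; _+_; _-_; _*_; _≤_; _<_; 0ℤ; 1ℤ; -1ℤ; +≤+; -≤+; -[1+_])
open import Data.Integer.Properties hiding (_≟_)
open import Data.Integer.Tactic.RingSolver using (solve-∀)
open import Data.List.Base as List using (List; []; _∷_)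
open import Data.List.Properties using (filter-++; length-++; map-tabulate)
open import Data.Nat.Base as ℕ using (ℕ; zero; suc; z≤n; _!)
open import Data.Nat.Properties as ℕₚ using ()
open import Data.Product.Base using (∃; _×_; _,_)
open import Data.Unit.Base using (⊤; tt)
open import Data.Vec.Base using (Vec; []; _∷_; lookup; map; tabulate; allFin)
open import Data.Vec.Properties using (lookup∘tabulate; map-lookup-allFin)
open import Function.Base using (_∘_; id)
open import Function.Bundles using (Equivalence)
open import Relation.Binary.PropositionalEquality as ≡ using (_≡_; _≢_; _≗_; refl; cong; cong₂; subst; trans; module ≡-Reasoning)
open import Relation.Nullary using (Dec; yes; no; does; ¬_; contradiction)
open import Relation.Nullary.Decidable using (map′; ¬?; _×-dec_; _→-dec_; from-no; decidable-stable)
open import Relation.Unary using (Pred; Decidable)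

open Algebra.Properties.Semiring.Sum +-*-semiring
  using (sum; sum-cong-≗; ∑-distrib-+; ∑-comm; *-distribˡ-sum; *-distribʳ-sum)

private
  variable
    n k : ℕ
    V W : Set

-- Sums

sum-mono : {f g : Fin n → ℤ} → (∀ i → f i ≤ g i) → sum f ≤ sum g
sum-mono {zero}  f≤g = ≤-refl
sum-mono {suc n} f≤g = +-mono-≤ (f≤g zero) (sum-mono (f≤g ∘ suc))

sum-nonneg : {f : Fin n → ℤ} → (∀ i → 0ℤ ≤ f i) → 0ℤ ≤ sum f
sum-nonneg {zero}  0≤f = ≤-refl
sum-nonneg {suc n} 0≤f = +-mono-≤ (0≤f zero) (sum-nonneg (0≤f ∘ suc))

sum-negative : {f : Fin (suc n) → ℤ} → (∀ i → f i < 0ℤ) → sum f < 0ℤ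
sum-negative {zero}  f<0 = +-mono-<-≤ (f<0 zero) ≤-refl
sum-negative {suc n} f<0 = +-mono-< (f<0 zero) (sum-negative (f<0 ∘ suc))

sum-const : ∀ n (c : ℤ) → sum {n} (λ _ → c) ≡ + n * c
sum-const zero    c = ≡.sym (*-zeroˡ c)
sum-const (suc n) c = begin
  c + sum {n} (λ _ → c)  ≡⟨ cong (_+_ c) (sum-const n c) ⟩
  c + + n * c            ≡⟨ suc-* (+ n) c ⟨
  + suc n * c            ∎
  where open ≡-Reasoning

sum₂ : (Fin n → Fin n → ℤ) → ℤ
sum₂ f = sum λ u → sum (f u)

sum₂-cong : {f g : Fin n → Fin n → ℤ} → (∀ u v → f u v ≡ g u v) → sum₂ f ≡ sum₂ g
sum₂-cong f≡g = sum-cong-≗ λ u → sum-cong-≗ (f≡g u)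

sum₂-+ : (f g : Fin n → Fin n → ℤ) → sum₂ (λ u v → f u v + g u v) ≡ sum₂ f + sum₂ g
sum₂-+ f g = trans (sum-cong-≗ λ u → ∑-distrib-+ (f u) (g u)) (∑-distrib-+ (sum ∘ f) (sum ∘ g))

sum₂-*ˡ : (c : ℤ) (f : Fin n → Fin n → ℤ) → sum₂ (λ u v → c * f u v) ≡ c * sum₂ f
sum₂-*ˡ c f = ≡.sym (trans (*-distribˡ-sum c (sum ∘ f)) (sum-cong-≗ λ u → *-distribˡ-sum c (f u)))

sum₂-const : ∀ n (c : ℤ) → sum₂ {n} (λ _ _ → c) ≡ + n * (+ n * c)
sum₂-const n c = trans (sum-cong-≗ {n} λ _ → sum-const n c) (sum-const n (+ n * c))

-- Runs over i < j by splitting off vertex `zero`, the recursion along which `rounding` settles one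
-- spin at a time.
pairSum : (Fin n → Fin n → ℤ) → ℤ
pairSum {zero}  f = 0ℤ
pairSum {suc n} f = sum (λ j → f zero (suc j)) + pairSum (λ i j → f (suc i) (suc j))

sum₂-pairSum : (f : Fin n → Fin n → ℤ) → (∀ i j → f i j ≡ f j i) → (∀ i → f i i ≡ 0ℤ) →
               sum₂ f ≡ + 2 * pairSum f
sum₂-pairSum {zero}  f f-sym f-diag = refl
sum₂-pairSum {suc n} f f-sym f-diag = begin
  (f zero zero + row) + sum (λ i → f (suc i) zero + sum (f (suc i) ∘ suc))
    ≡⟨ cong₂ _+_ (cong (_+ row) (f-diag zero))
         (∑-distrib-+ (λ i → f (suc i) zero) (λ i → sum (f (suc i) ∘ suc))) ⟩
  (0ℤ + row) + (sum (λ i → f (suc i) zero) + sum₂ f′)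
    ≡⟨ cong₂ (λ p q → (0ℤ + row) + (p + q)) (sum-cong-≗ λ i → f-sym (suc i) zero)
         (sum₂-pairSum f′ (λ i j → f-sym (suc i) (suc j)) (f-diag ∘ suc)) ⟩
  (0ℤ + row) + (row + + 2 * pairSum f′)
    ≡⟨ double row (pairSum f′) ⟩
  + 2 * (row + pairSum f′) ∎
  where
  open ≡-Reasoning
  f′ : Fin n → Fin n → ℤ
  f′ i j = f (suc i) (suc j)
  row : ℤ
  row = sum λ j → f zero (suc j)
  double : ∀ p q → (0ℤ + p) + (p + + 2 * q) ≡ + 2 * (p + q)
  double = solve-∀

-- Tuples may repeat vertices; `symSum-form-negative` covers those too.
tupleSum : ∀ k → (Vec (Fin n) k → ℤ) → ℤ
tupleSum zero    F = F []
tupleSum (suc k) F = sum λ a → tupleSum k (F ∘ (a ∷_))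

tupleSum-+ : ∀ k (F G : Vec (Fin n) k → ℤ) → tupleSum k (λ v → F v + G v) ≡ tupleSum k F + tupleSum k G
tupleSum-+ zero    F G = refl
tupleSum-+ (suc k) F G =
  trans (sum-cong-≗ λ a → tupleSum-+ k (F ∘ (a ∷_)) (G ∘ (a ∷_)))
        (∑-distrib-+ (λ a → tupleSum k (F ∘ (a ∷_))) (λ a → tupleSum k (G ∘ (a ∷_))))

tupleSum-negative : ∀ k {F : Vec (Fin (suc n)) k → ℤ} → (∀ v → F v < 0ℤ) → tupleSum k F < 0ℤ
tupleSum-negative zero    F<0 = F<0 []
tupleSum-negative (suc k) F<0 = sum-negative λ a → tupleSum-negative k λ v → F<0 (a ∷ v)

-- Symmetrisation

-- `F` is evaluated at all `suc k` ways to insert one element into the vector.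
insSum : (Vec V (suc k) → ℤ) → V → Vec V k → ℤ
insSum F a []       = F (a ∷ [])
insSum F a (b ∷ bs) = F (a ∷ b ∷ bs) + insSum (F ∘ (b ∷_)) a bs

-- Runs over all k! orderings, each built by inserting the head into an ordering of the tail.
symSum : (Vec V k → ℤ) → Vec V k → ℤ
symSum F []       = F []
symSum F (a ∷ as) = symSum (insSum F a) as

insSum-cong : {F G : Vec V (suc k) → ℤ} → F ≗ G → ∀ a → insSum F a ≗ insSum G a
insSum-cong F≗G a []       = F≗G _
insSum-cong F≗G a (b ∷ bs) = cong₂ _+_ (F≗G _) (insSum-cong (λ v → F≗G (b ∷ v)) a bs)

symSum-cong : {F G : Vec V k → ℤ} → F ≗ G → symSum F ≗ symSum G
symSum-cong F≗G []       = F≗G []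
symSum-cong F≗G (a ∷ as) = symSum-cong (insSum-cong F≗G a) as

insSum-map : (f : V → W) (F : Vec W (suc k) → ℤ) (a : V) (bs : Vec V k) →
             insSum F (f a) (map f bs) ≡ insSum (F ∘ map f) a bs
insSum-map f F a []       = refl
insSum-map f F a (b ∷ bs) = cong (_+_ (F (map f (a ∷ b ∷ bs)))) (insSum-map f (F ∘ (f b ∷_)) a bs)

symSum-map : (f : V → W) (F : Vec W k → ℤ) (as : Vec V k) → symSum F (map f as) ≡ symSum (F ∘ map f) as
symSum-map f F []       = refl
symSum-map f F (a ∷ as) =
  trans (symSum-map f (insSum F (f a)) as) (symSum-cong (insSum-map f F a) as)

-- Each of the `suc k` insertion places yields the full tuple sum after renaming summation
-- variables. In the induction `∑-comm` moves `a` past `b`.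
tupleSum-insSum : ∀ k (F : Vec (Fin n) (suc k) → ℤ) →
                  sum (λ a → tupleSum k (insSum F a)) ≡ + suc k * tupleSum (suc k) F
tupleSum-insSum zero    F = ≡.sym (*-identityˡ _)
tupleSum-insSum {n} (suc k) F = begin
  sum (λ a → sum λ b → tupleSum k λ bs → F (a ∷ b ∷ bs) + insSum (F ∘ (b ∷_)) a bs)
    ≡⟨ sum₂-cong {n} (λ a b → tupleSum-+ k (λ bs → F (a ∷ b ∷ bs)) (insSum (F ∘ (b ∷_)) a)) ⟩
  sum₂ (λ a b → first a b + rest a b)
    ≡⟨ sum₂-+ first rest ⟩
  total + sum₂ rest
    ≡⟨ cong (_+_ total) (∑-comm rest) ⟩
  total + sum (λ b → sum λ a → rest a b)
    ≡⟨ cong (_+_ total) (sum-cong-≗ λ b → tupleSum-insSum k (F ∘ (b ∷_))) ⟩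
  total + sum (λ b → + suc k * tupleSum (suc k) (F ∘ (b ∷_)))
    ≡⟨ cong (_+_ total) (*-distribˡ-sum (+ suc k) (λ b → tupleSum (suc k) (F ∘ (b ∷_)))) ⟨
  total + + suc k * total
    ≡⟨ suc-* (+ suc k) total ⟨
  + suc (suc k) * total ∎
  where
  open ≡-Reasoning
  first rest : Fin n → Fin n → ℤ
  first a b = tupleSum k (λ bs → F (a ∷ b ∷ bs))
  rest a b = tupleSum k (insSum (F ∘ (b ∷_)) a)
  total : ℤ
  total = tupleSum (suc (suc k)) F

-- Reordering permutes the summation variables, so all k! orderings have the same total. The sign of
-- `tupleSum` can thus be judged on the symmetrised summand.
tupleSum-symSum : ∀ k (F : Vec (Fin n) k → ℤ) → tupleSum k (symSum F) ≡ + (k !) * tupleSum k F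
tupleSum-symSum zero    F = ≡.sym (*-identityˡ _)
tupleSum-symSum (suc k) F = begin
  sum (λ a → tupleSum k (symSum (insSum F a)))
    ≡⟨ sum-cong-≗ (λ a → tupleSum-symSum k (insSum F a)) ⟩
  sum (λ a → + (k !) * tupleSum k (insSum F a))
    ≡⟨ *-distribˡ-sum (+ (k !)) (λ a → tupleSum k (insSum F a)) ⟨
  + (k !) * sum (λ a → tupleSum k (insSum F a))
    ≡⟨ cong (_*_ (+ (k !))) (tupleSum-insSum k F) ⟩
  + (k !) * (+ suc k * tupleSum (suc k) F)
    ≡⟨ regroup (+ (k !)) (+ suc k) _ ⟩
  + suc k * + (k !) * tupleSum (suc k) F
    ≡⟨ cong (_* tupleSum (suc k) F) (pos-* (suc k) (k !)) ⟨
  + (suc k !) * tupleSum (suc k) F ∎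
  where
  open ≡-Reasoning
  regroup : ∀ p q r → p * (q * r) ≡ q * p * r
  regroup = solve-∀

-- Spins

data Spin : Set where
  down idle up : Spin

⟦_⟧ : Spin → ℤ
⟦ down ⟧ = -1ℤ
⟦ idle ⟧ = 0ℤ
⟦ up ⟧   = 1ℤ

side : Bool → Spin
side true  = up
side false = down

-- An Ising energy with couplings `a` and external field `b`. The field starts at zero and records
-- the effect of spins already fixed in `rounding`.
energy : (Fin n → Fin n → ℤ) → (Fin n → ℤ) → (Fin n → Spin) → ℤ
energy a b s = sum (λ i → b i * ⟦ s i ⟧) + pairSum (λ i j → a i j * (⟦ s i ⟧ * ⟦ s j ⟧))

energy-noField : (a : Fin n → Fin n → ℤ) (s : Fin n → Spin) →
                 energy a (λ _ → 0ℤ) s ≡ pairSum (λ i j → a i j * (⟦ s i ⟧ * ⟦ s j ⟧))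
energy-noField {n} a s = begin
  sum (λ i → 0ℤ * ⟦ s i ⟧) + interaction
    ≡⟨ cong (_+ interaction) (*-distribˡ-sum 0ℤ (⟦_⟧ ∘ s)) ⟨
  0ℤ * sum (⟦_⟧ ∘ s) + interaction
    ≡⟨ cong (_+ interaction) (*-zeroˡ (sum (⟦_⟧ ∘ s))) ⟩
  0ℤ + interaction
    ≡⟨ +-identityˡ interaction ⟩
  interaction ∎
  where
  open ≡-Reasoning
  interaction : ℤ
  interaction = pairSum λ i j → a i j * (⟦ s i ⟧ * ⟦ s j ⟧)

module _ (a : Fin (suc n) → Fin (suc n) → ℤ) (b : Fin (suc n) → ℤ) where

  private
    coupling : Fin n → ℤ
    coupling j = a zero (suc j)

    a′ : Fin n → Fin n → ℤ
    a′ i j = a (suc i) (suc j)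

  field₀ : (Fin n → Spin) → ℤ
  field₀ s = b zero + sum (λ j → coupling j * ⟦ s j ⟧)

  -- No pair joins a vertex to itself, so no spin is squared: the energy is affine in the spin of
  -- `zero`, with slope `field₀`.
  energy-head : (s : Fin (suc n) → Spin) →
                energy a b s ≡ ⟦ s zero ⟧ * field₀ (s ∘ suc) + energy a′ (b ∘ suc) (s ∘ suc)
  energy-head s = begin
    (b zero * e + linear) + (sum (λ j → coupling j * (e * ⟦ s (suc j) ⟧)) + rest)
      ≡⟨ cong (λ p → (b zero * e + linear) + (p + rest)) (begin
           sum (λ j → coupling j * (e * ⟦ s (suc j) ⟧))  ≡⟨ sum-cong-≗ (λ j → swap (coupling j) e ⟦ s (suc j) ⟧) ⟩
           sum (λ j → e * (coupling j * ⟦ s (suc j) ⟧))  ≡⟨ *-distribˡ-sum e (λ j → coupling j * ⟦ s (suc j) ⟧) ⟨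
           e * sum (λ j → coupling j * ⟦ s (suc j) ⟧)    ∎) ⟩
    (b zero * e + linear) + (e * sum (λ j → coupling j * ⟦ s (suc j) ⟧) + rest)
      ≡⟨ regroup (b zero) e linear _ rest ⟩
    e * field₀ (s ∘ suc) + (linear + rest) ∎
    where
    open ≡-Reasoning
    e linear rest : ℤ
    e = ⟦ s zero ⟧
    linear = sum λ i → b (suc i) * ⟦ s (suc i) ⟧
    rest = pairSum λ i j → a′ i j * (⟦ s (suc i) ⟧ * ⟦ s (suc j) ⟧)
    swap : ∀ p q r → p * (q * r) ≡ q * (p * r)
    swap = solve-∀
    regroup : ∀ b₀ e l c r → (b₀ * e + l) + (e * c + r) ≡ e * (b₀ + c) + (l + r)
    regroup = solve-∀

  -- Once `zero` has spin `e`, its couplings act on the other vertices as additional field, leaving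
  -- the same kind of problem with one vertex fewer.
  field-shift : (e : ℤ) (s : Fin n → Spin) →
                e * field₀ s + energy a′ (b ∘ suc) s ≡
                e * b zero + energy a′ (λ j → b (suc j) + e * coupling j) s
  field-shift e s = begin
    e * field₀ s + (linear + rest)
      ≡⟨ regroup e (b zero) (sum (λ j → coupling j * ⟦ s j ⟧)) linear rest ⟩
    e * b zero + ((linear + e * sum (λ j → coupling j * ⟦ s j ⟧)) + rest)
      ≡⟨ cong (λ p → e * b zero + ((linear + p) + rest)) (*-distribˡ-sum e (λ j → coupling j * ⟦ s j ⟧)) ⟩
    e * b zero + ((linear + sum (λ j → e * (coupling j * ⟦ s j ⟧))) + rest)
      ≡⟨ cong (λ p → e * b zero + (p + rest)) (∑-distrib-+ (λ j → b (suc j) * ⟦ s j ⟧) _) ⟨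
    e * b zero + (sum (λ j → b (suc j) * ⟦ s j ⟧ + e * (coupling j * ⟦ s j ⟧)) + rest)
      ≡⟨ cong (λ p → e * b zero + (p + rest))
           (sum-cong-≗ λ j → factor (b (suc j)) e (coupling j) ⟦ s j ⟧) ⟩
    e * b zero + (sum (λ j → (b (suc j) + e * coupling j) * ⟦ s j ⟧) + rest) ∎
    where
    open ≡-Reasoning
    linear rest : ℤ
    linear = sum λ j → b (suc j) * ⟦ s j ⟧
    rest = pairSum λ i j → a′ i j * (⟦ s i ⟧ * ⟦ s j ⟧)
    regroup : ∀ e b₀ c l r → e * (b₀ + c) + (l + r) ≡ e * b₀ + ((l + e * c) + r)
    regroup = solve-∀
    factor : ∀ b e c t → b * t + e * (c * t) ≡ (b + e * c) * t
    factor = solve-∀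

bestSide : ∀ s m → ∃ λ ε → ⟦ side ε ⟧ * m ≤ ⟦ s ⟧ * m
bestSide down m = false , ≤-refl
bestSide up   m = true  , ≤-refl
-- An idle spin contributes 0, so a side whose sign is opposite to the slope does no worse.
bestSide idle (+ m)        = false , subst (_≤ 0ℤ) (≡.sym (-1*i≡-i (+ m))) (neg-mono-≤ {0ℤ} {+ m} (+≤+ z≤n))
bestSide idle -[1+ m ]     = true  , -≤+

-- The method of conditional expectations: an affine function on [-1, 1] is minimal at an end, so
-- the first spin becomes a side while the others stay as in `s`. The induction continues with the
-- shifted field.
rounding : (a : Fin n → Fin n → ℤ) (b : Fin n → ℤ) (s : Fin n → Spin) →
           ∃ λ c → energy a b (side ∘ lookup c) ≤ energy a b s
rounding {zero}  a b s = [] , ≤-refl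
rounding {suc n} a b s with bestSide (s zero) (field₀ a b (s ∘ suc))
... | ε , better with rounding (λ i j → a (suc i) (suc j)) (λ j → b (suc j) + ⟦ side ε ⟧ * a zero (suc j)) (s ∘ suc)
... | c , smaller = ε ∷ c , (begin
  energy a b (side ∘ lookup (ε ∷ c))
    ≡⟨ energy-head a b (side ∘ lookup (ε ∷ c)) ⟩
  e * field₀ a b (side ∘ lookup c) + energy a′ (b ∘ suc) (side ∘ lookup c)
    ≡⟨ field-shift a b e (side ∘ lookup c) ⟩
  e * b zero + energy a′ b′ (side ∘ lookup c)
    ≤⟨ +-monoʳ-≤ (e * b zero) smaller ⟩
  e * b zero + energy a′ b′ (s ∘ suc)
    ≡⟨ field-shift a b e (s ∘ suc) ⟨
  e * field₀ a b (s ∘ suc) + energy a′ (b ∘ suc) (s ∘ suc)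
    ≤⟨ +-monoˡ-≤ (energy a′ (b ∘ suc) (s ∘ suc)) better ⟩
  ⟦ s zero ⟧ * field₀ a b (s ∘ suc) + energy a′ (b ∘ suc) (s ∘ suc)
    ≡⟨ energy-head a b s ⟨
  energy a b s ∎)
  where
  open ≤-Reasoning
  e : ℤ
  e = ⟦ side ε ⟧
  a′ : Fin n → Fin n → ℤ
  a′ i j = a (suc i) (suc j)
  b′ : Fin n → ℤ
  b′ j = b (suc j) + e * a zero (suc j)

-- The certificate

indicator : Bool → ℤ
indicator b = if b then 1ℤ else 0ℤ

-- 50 a (1 + s t) − 29, where (1 + s t) / 2 is the probability that independent vertices
-- with spins s and t receive the same colour.
excess : Bool → Spin → Spin → ℤ
excess a s t = + 50 * indicator a * (1ℤ + ⟦ s ⟧ * ⟦ t ⟧) - + 29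

Profile : Set
Profile = Bool × Bool × Bool

-- The letters name those of a, b, c to which a vertex is adjacent.
pattern ∅   = false , false , false
pattern A   = true  , false , false
pattern B   = false , true  , false
pattern C   = false , false , true
pattern AB  = true  , true  , false
pattern AC  = true  , false , true
pattern BC  = false , true  , true
pattern ABC = true  , true  , true

table : (_ _ _ _ _ _ _ _ : ℤ) → Profile → ℤ
table w₀ wᴬ wᴮ wᶜ wᴬᴮ wᴬᶜ wᴮᶜ w₁ ∅   = w₀
table w₀ wᴬ wᴮ wᶜ wᴬᴮ wᴬᶜ wᴮᶜ w₁ A   = wᴬ
table w₀ wᴬ wᴮ wᶜ wᴬᴮ wᴬᶜ wᴮᶜ w₁ B   = wᴮ
table w₀ wᴬ wᴮ wᶜ wᴬᴮ wᴬᶜ wᴮᶜ w₁ C   = wᶜ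
table w₀ wᴬ wᴮ wᶜ wᴬᴮ wᴬᶜ wᴮᶜ w₁ AB  = wᴬᴮ
table w₀ wᴬ wᴮ wᶜ wᴬᴮ wᴬᶜ wᴮᶜ w₁ AC  = wᴬᶜ
table w₀ wᴬ wᴮ wᶜ wᴬᴮ wᴬᶜ wᴮᶜ w₁ BC  = wᴮᶜ
table w₀ wᴬ wᴮ wᶜ wᴬᴮ wᴬᶜ wᴮᶜ w₁ ABC = w₁

-- Vertices adjacent to exactly one of b, c are split by which one it is, those adjacent to both are
-- split by a, and the rest stay random. In a complete 4-partite graph this puts the parts of a and
-- c on one side, and the part of b and the fourth part on the other.
triangleSpin : Profile → Spin
triangleSpin ∅   = idle
triangleSpin A   = idle
triangleSpin B   = up
triangleSpin C   = down
triangleSpin AB  = up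
triangleSpin AC  = down
triangleSpin BC  = up
triangleSpin ABC = down

-- The two sources of non-negative double sums once a, b, c are fixed: the assumption on spin
-- assignments, and squares of sums.
data Term : Set where
  cut    : (Profile → Spin) → Term
  square : (Profile → ℤ) → Term

-- The shape of a triple abc lists the adjacencies ab, ac, bc, so that AB stands for a path with
-- centre a here.  The multipliers and tables are a rounded numerical solution of the semidefinite
-- program given by the sign condition of `certified`.
certificate : Profile → List (ℕ × Term)
certificate shape = (9 , cut (λ _ → idle)) ∷ special shape
  where
  special : Profile → List (ℕ × Term)
  -- Each table below is even or odd under some exchange of two of a, b, c that preserves the shape.
  special A =
    (1600  , square (table (+ 1) (+ 0) (+ 0) (- + 1) (+ 2) (+ 0) (+ 0) (- + 1))) ∷ []
  special AB =
    (24300 , square (table (+ 0) (+ 0) (+ 0) (+ 0) (+ 1) (- + 1) (+ 0) (+ 0))) ∷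
    (1600  , square (table (+ 0) (+ 0) (+ 1) (- + 1) (+ 2) (- + 2) (+ 0) (+ 0))) ∷
    (400   , square (table (+ 2) (+ 1) (- + 2) (- + 2) (+ 3) (+ 3) (- + 1) (- + 1))) ∷ []
  special ABC =
    (216   , cut triangleSpin) ∷
    (1900  , square (table (+ 0) (- + 1) (- + 1) (- + 1) (+ 0) (+ 0) (+ 0) (+ 2))) ∷
    (5600  , square (table (+ 0) (+ 0) (+ 0) (+ 0) (+ 1) (- + 1) (+ 0) (+ 0))) ∷
    (2400  , square (table (+ 0) (+ 1) (- + 1) (+ 0) (+ 0) (- + 1) (+ 1) (+ 0))) ∷
    (1000  , square (table (+ 1) (- + 1) (- + 1) (- + 1) (- + 1) (- + 1) (- + 1) (+ 3))) ∷ []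
  -- Other labellings of one edge or of a path get nothing extra: `symSum` visits every ordering of
  -- a, b, c, so one labelling of each shape suffices.
  special _ = []

value : Term → Bool → Profile → Profile → ℤ
value (cut σ)    a p q = excess a (σ p) (σ q)
value (square w) a p q = w p * w q

combine : List (ℕ × Term) → Bool → Profile → Profile → ℤ
combine []             a p q = 0ℤ
combine ((c , t) ∷ ts) a p q = + c * value t a p q + combine ts a p q

-- The vertices a, b, c are roots, and u, v are the variables of the double sums. Only adjacencies
-- among the five enter, which makes the sign condition a finite check.
form : (V → V → Bool) → Vec V 5 → ℤ
form _~_ (a ∷ b ∷ c ∷ u ∷ v ∷ []) =
  combine (certificate (a ~ b , a ~ c , b ~ c)) (u ~ v) (profile u) (profile v)
  where
  profile = λ w → a ~ w , b ~ w , c ~ w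

form-cong : {_~_ _≈_ : V → V → Bool} → (∀ u v → (u ~ v) ≡ (u ≈ v)) → form _~_ ≗ form _≈_
form-cong ~≡≈ (a ∷ b ∷ c ∷ u ∷ v ∷ [])
  rewrite ~≡≈ a b | ~≡≈ a c | ~≡≈ b c | ~≡≈ u v
        | ~≡≈ a u | ~≡≈ b u | ~≡≈ c u | ~≡≈ a v | ~≡≈ b v | ~≡≈ c v = refl

form-map : (_~_ : W → W → Bool) (f : V → W) → form _~_ ∘ map f ≗ form (λ u v → f u ~ f v)
form-map _~_ f (a ∷ b ∷ c ∷ u ∷ v ∷ []) = refl

-- The five-vertex graphs

-- The rows of the adjacency matrix above the diagonal: ten bits for five vertices. Symmetry and
-- irreflexivity then hold by construction.
Code : ℕ → Set
Code zero    = ⊤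
Code (suc n) = Vec Bool n × Code n

decode : Code n → Fin n → Fin n → Bool
decode (_ , _)   zero    zero    = false
decode (row , _) zero    (suc j) = lookup row j
decode (row , _) (suc i) zero    = lookup row i
decode (_ , g)   (suc i) (suc j) = decode g i j

encode : (Fin n → Fin n → Bool) → Code n
encode {zero}  _~_ = tt
encode {suc n} _~_ = tabulate (λ j → zero ~ suc j) , encode (λ i j → suc i ~ suc j)

decode-encode : (_~_ : Fin n → Fin n → Bool) → (∀ i j → (i ~ j) ≡ (j ~ i)) → (∀ i → (i ~ i) ≡ false) →
                ∀ i j → (i ~ j) ≡ decode (encode _~_) i j
decode-encode _~_ ~-sym ~-irrefl zero    zero    = ~-irrefl zero
decode-encode _~_ ~-sym ~-irrefl zero    (suc j) = ≡.sym (lookup∘tabulate _ j)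
decode-encode _~_ ~-sym ~-irrefl (suc i) zero    = trans (~-sym (suc i) zero) (≡.sym (lookup∘tabulate _ i))
decode-encode _~_ ~-sym ~-irrefl (suc i) (suc j) =
  decode-encode (λ i j → suc i ~ suc j) (λ i j → ~-sym (suc i) (suc j)) (~-irrefl ∘ suc) i j

anyCode? : ∀ n {P : Code n → Set} → (∀ g → Dec (P g)) → Dec (∃ P)
anyCode? zero    P? = map′ (tt ,_) (λ { (tt , p) → p }) (P? tt)
anyCode? (suc n) P? =
  map′ (λ { (row , g , p) → (row , g) , p }) (λ { ((row , g) , p) → row , g , p })
       (anySubset? λ row → anyCode? n λ g → P? (row , g))

Complete : (Fin n → Fin n → Bool) → Set
Complete _~_ = ∀ i j → i ≢ j → (i ~ j) ≡ true

complete? : (_~_ : Fin n → Fin n → Bool) → Dec (Complete _~_)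
complete? _~_ = all? λ i → all? λ j → ¬? (i ≟ᶠ j) →-dec ((i ~ j) ≟ᵇ true)

-- Settled by evaluation over all 1024 labelled graphs on five vertices.
certified : ¬ ∃ λ g → ¬ Complete (decode g) × ¬ symSum (form (decode g)) (allFin 5) < 0ℤ
certified = from-no (anyCode? 5 λ g →
  ¬? (complete? (decode g)) ×-dec ¬? (symSum (form (decode g)) (allFin 5) <? 0ℤ))

-- The adjacencies within `t` form a graph on `Fin 5`, even if `t` repeats vertices. Were it
-- complete, irreflexivity would make the entries of `t` distinct, giving a K5; so `certified`
-- applies.
symSum-form-negative : (G : Graph n) → K5-free G → ∀ t → symSum (form (adj G)) t < 0ℤ
symSum-form-negative {n} G K5-free-G t =
  subst (_< 0ℤ) (≡.sym symSum≡) (decidable-stable (_ <? _) λ ≮0 → certified (code , incomplete , ≮0))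
  where
  _~_ : Fin 5 → Fin 5 → Bool
  i ~ j = adj G (lookup t i) (lookup t j)

  code : Code 5
  code = encode _~_

  ~≡decode : ∀ i j → (i ~ j) ≡ decode code i j
  ~≡decode = decode-encode _~_ (λ i j → Graph.sym G _ _) (λ i → Graph.irrefl G _)

  incomplete : ¬ Complete (decode code)
  incomplete complete = K5-free-G (lookup t , injective , λ i j i≢j → Equivalence.from T-≡ (adjacent i j i≢j))
    where
    adjacent : Complete _~_
    adjacent i j i≢j = trans (~≡decode i j) (complete i j i≢j)

    injective : ∀ {i j} → lookup t i ≡ lookup t j → i ≡ j
    injective {i} {j} tᵢ≡tⱼ = decidable-stable (i ≟ᶠ j) λ i≢j →
      contradiction (trans (≡.sym (adjacent i j i≢j)) (trans (cong (adj G (lookup t i)) (≡.sym tᵢ≡tⱼ)) (Graph.irrefl G _))) λ ()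

  symSum≡ : symSum (form (adj G)) t ≡ symSum (form (decode code)) (allFin 5)
  symSum≡ = begin
    symSum (form (adj G)) t
      ≡⟨ cong (symSum (form (adj G))) (map-lookup-allFin t) ⟨
    symSum (form (adj G)) (map (lookup t) (allFin 5))
      ≡⟨ symSum-map (lookup t) (form (adj G)) (allFin 5) ⟩
    symSum (form (adj G) ∘ map (lookup t)) (allFin 5)
      ≡⟨ symSum-cong (λ v → trans (form-map (adj G) (lookup t) v) (form-cong ~≡decode v)) (allFin 5) ⟩
    symSum (form (decode code)) (allFin 5) ∎
    where open ≡-Reasoning

-- Non-negativity of the sum over 5-tuples

module _ (_~_ : Fin n → Fin n → Bool)
         (excess-nonneg : (s : Fin n → Spin) → 0ℤ ≤ sum₂ (λ u v → excess (u ~ v) (s u) (s v))) where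

  -- A cut is the assumption applied to the spins `σ ∘ τ`; for a square, the double sum factors as
  -- the square of a single sum.
  value-nonneg : ∀ t (τ : Fin n → Profile) → 0ℤ ≤ sum₂ (λ u v → value t (u ~ v) (τ u) (τ v))
  value-nonneg (cut σ)    τ = excess-nonneg (σ ∘ τ)
  value-nonneg (square w) τ = subst (0ℤ ≤_) (≡.sym factor) (square-nonneg (sum (w ∘ τ)))
    where
    factor : sum₂ (λ u v → w (τ u) * w (τ v)) ≡ sum (w ∘ τ) * sum (w ∘ τ)
    factor = trans (sum-cong-≗ λ u → ≡.sym (*-distribˡ-sum (w (τ u)) (w ∘ τ)))
                   (≡.sym (*-distribʳ-sum (sum (w ∘ τ)) (w ∘ τ)))
    square-nonneg : ∀ i → 0ℤ ≤ i * i
    square-nonneg (+ m)    = subst (0ℤ ≤_) (pos-* m m) (+≤+ z≤n)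
    square-nonneg -[1+ m ] = +≤+ z≤n

  combine-nonneg : ∀ ts (τ : Fin n → Profile) → 0ℤ ≤ sum₂ (λ u v → combine ts (u ~ v) (τ u) (τ v))
  combine-nonneg []             τ = sum-nonneg {n} λ u → sum-nonneg {n} λ v → ≤-refl
  combine-nonneg ((c , t) ∷ ts) τ = begin
    0ℤ
      ≡⟨ *-zeroʳ (+ c) ⟨
    + c * 0ℤ
      ≤⟨ *-monoˡ-≤-nonNeg (+ c) (value-nonneg t τ) ⟩
    + c * sum₂ first
      ≡⟨ +-identityʳ _ ⟨
    + c * sum₂ first + 0ℤ
      ≤⟨ +-monoʳ-≤ (+ c * sum₂ first) (combine-nonneg ts τ) ⟩
    + c * sum₂ first + sum₂ rest
      ≡⟨ cong (_+ sum₂ rest) (sum₂-*ˡ (+ c) first) ⟨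
    sum₂ (λ u v → + c * first u v) + sum₂ rest
      ≡⟨ sum₂-+ (λ u v → + c * first u v) rest ⟨
    sum₂ (λ u v → + c * first u v + rest u v) ∎
    where
    open ≤-Reasoning
    first rest : Fin n → Fin n → ℤ
    first u v = value t (u ~ v) (τ u) (τ v)
    rest u v = combine ts (u ~ v) (τ u) (τ v)

  tupleSum-form-nonneg : 0ℤ ≤ tupleSum 5 (form _~_)
  tupleSum-form-nonneg = sum-nonneg λ a → sum-nonneg λ b → sum-nonneg λ c →
    combine-nonneg (certificate (a ~ b , a ~ c , b ~ c)) (λ w → a ~ w , b ~ w , c ~ w)

-- The symmetrised sum is negative termwise, yet equals 120 times a non-negative sum. A vertex must
-- exist, since an empty sum is not negative.
excess-somewhere-negative : (G : Graph (suc n)) → K5-free G →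
  ¬ ((s : Fin (suc n) → Spin) → 0ℤ ≤ sum₂ (λ u v → excess (adj G u v) (s u) (s v)))
excess-somewhere-negative G K5-free-G excess-nonneg = <⇒≱
  (tupleSum-negative 5 (symSum-form-negative G K5-free-G))
  (subst (0ℤ ≤_) (≡.sym (tupleSum-symSum 5 (form (adj G))))
    (*-monoˡ-≤-nonNeg (+ (5 !)) (tupleSum-form-nonneg (adj G) excess-nonneg)))

-- Monochromatic edges

monochromatic : (G : Graph n) → Vec Bool n → EdgeSubset G
monochromatic G c = record
  { mem    = λ u v → adj G u v ∧ not (lookup c u xor lookup c v)
  ; memSym = λ u v → cong₂ _∧_ (Graph.sym G u v) (cong not (xor-comm (lookup c u) (lookup c v)))
  ; memSub = λ u v → ∧-projˡ (adj G u v)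
  }
  where
  ∧-projˡ : ∀ p {q} → T (p ∧ q) → T p
  ∧-projˡ true _ = tt

monochromatic-bipartite : (G : Graph n) (c : Vec Bool n) → BipartiteAfterDeleting G (monochromatic G c)
monochromatic-bipartite G c = lookup c , λ u v uv uv∉F cᵤ≡cᵥ →
  uv∉F (Equivalence.from T-≡ (cong₂ (λ a d → a ∧ not d) (Equivalence.to T-≡ uv)
    (trans (cong (_xor lookup c v) cᵤ≡cᵥ) (xor-same (lookup c v)))))

module _ {a p} {A : Set a} {P : Pred A p} (P? : Decidable P) where

  count : List A → ℤ
  count xs = + List.length (List.filter P? xs)

  count-tabulate : (f : Fin n → A) → count (List.tabulate f) ≡ sum (λ i → indicator (does (P? (f i))))
  count-tabulate {zero}  f = refl
  count-tabulate {suc n} f with does (P? (f zero))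
  ... | true  = cong (_+_ 1ℤ) (count-tabulate (f ∘ suc))
  ... | false = trans (count-tabulate (f ∘ suc)) (≡.sym (+-identityˡ _))

  count-concat-tabulate : (f : Fin n → List A) → count (List.concat (List.tabulate f)) ≡ sum (count ∘ f)
  count-concat-tabulate {zero}  f = refl
  count-concat-tabulate {suc n} f = begin
    count (f zero List.++ rest)
      ≡⟨ cong (+_ ∘ List.length) (filter-++ P? (f zero) rest) ⟩
    + List.length (List.filter P? (f zero) List.++ List.filter P? rest)
      ≡⟨ cong +_ (length-++ (List.filter P? (f zero))) ⟩
    + (List.length (List.filter P? (f zero)) ℕ.+ List.length (List.filter P? rest))
      ≡⟨ pos-+ (List.length (List.filter P? (f zero))) _ ⟩
    count (f zero) + count rest
      ≡⟨ cong (_+_ (count (f zero))) (count-concat-tabulate (f ∘ suc)) ⟩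
    count (f zero) + sum (count ∘ f ∘ suc) ∎
    where
    open ≡-Reasoning
    rest : List A
    rest = List.concat (List.tabulate (f ∘ suc))

count-pairs : ∀ {p} {P : Pred (Fin n × Fin n) p} (P? : Decidable P) →
              count P? (pairs n) ≡ sum₂ (λ u v → indicator (does (P? (u , v))))
count-pairs {n} P? = begin
  count P? (pairs n)
    ≡⟨ cong (count P? ∘ List.concat) (map-tabulate id row) ⟩
  count P? (List.concat (List.tabulate row))
    ≡⟨ count-concat-tabulate P? row ⟩
  sum (λ u → count P? (row u))
    ≡⟨ sum-cong-≗ (λ u → trans (cong (count P?) (map-tabulate id (u ,_))) (count-tabulate P? (u ,_))) ⟩
  sum₂ (λ u v → indicator (does (P? (u , v)))) ∎
  where
  open ≡-Reasoning
  row : Fin n → List (Fin n × Fin n)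
  row u = List.map (u ,_) (List.allFin n)

indicator-disjoint : ∀ {P Q : Set} (P? : Dec P) (Q? : Dec Q) → (P → ¬ Q) → ∀ m →
  indicator (does P? ∧ does (m ≟ᵇ true)) + indicator (does Q? ∧ does (m ≟ᵇ true)) ≤ indicator m
indicator-disjoint (yes p) (yes q) disjoint m     = contradiction q (disjoint p)
indicator-disjoint (yes _) (no _)  disjoint true  = ≤-refl
indicator-disjoint (yes _) (no _)  disjoint false = ≤-refl
indicator-disjoint (no _)  (yes _) disjoint true  = ≤-refl
indicator-disjoint (no _)  (yes _) disjoint false = ≤-refl
indicator-disjoint (no _)  (no _)  disjoint true  = +≤+ z≤n
indicator-disjoint (no _)  (no _)  disjoint false = ≤-refl

-- `size` counts an edge in its increasing order only. Adding the transposed sum accounts for both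
-- orders, and no ordered pair is increasing both ways.
double-size : {G : Graph n} (F : EdgeSubset G) → + 2 * + size F ≤ sum₂ (λ u v → indicator (mem F u v))
double-size {n} F = begin
  + 2 * + size F
    ≡⟨ cong (_*_ (+ 2)) (count-pairs below?) ⟩
  + 2 * sum₂ below
    ≡⟨ twice (sum₂ below) ⟩
  sum₂ below + sum₂ below
    ≡⟨ cong (_+_ (sum₂ below)) (∑-comm below) ⟩
  sum₂ below + sum₂ (λ u v → below v u)
    ≡⟨ sum₂-+ below (λ u v → below v u) ⟨
  sum₂ (λ u v → below u v + below v u)
    ≤⟨ sum-mono (λ u → sum-mono (below-above u)) ⟩
  sum₂ (λ u v → indicator (mem F u v)) ∎
  where
  open ≤-Reasoning
  below? : Decidable λ ((u , v) : Fin n × Fin n) → toℕ u ℕ.< toℕ v × mem F u v ≡ true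
  below? (u , v) = (toℕ u ℕₚ.<? toℕ v) ×-dec (mem F u v ≟ᵇ true)
  below : Fin n → Fin n → ℤ
  below u v = indicator (does (below? (u , v)))
  below-above : ∀ u v → below u v + below v u ≤ indicator (mem F u v)
  below-above u v rewrite memSym F v u =
    indicator-disjoint (toℕ u ℕₚ.<? toℕ v) (toℕ v ℕₚ.<? toℕ u) (λ u<v v<u → ℕₚ.<-asym u<v v<u) (mem F u v)
  twice : ∀ p → + 2 * p ≡ p + p
  twice = solve-∀

-- For actual colours 1 + s t is 2 or 0, which turns the factor 50 into 100 on monochromatic edges.
excess-side : ∀ a p q → excess a (side p) (side q) ≡ + 100 * indicator (a ∧ not (p xor q)) + - + 29
excess-side true  true  true  = refl
excess-side true  true  false = refl
excess-side true  false true  = refl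
excess-side true  false false = refl
excess-side false true  true  = refl
excess-side false true  false = refl
excess-side false false true  = refl
excess-side false false false = refl

-- Total excess of a spin assignment

module _ (G : Graph n) where

  private
    totalExcess : (Fin n → Spin) → ℤ
    totalExcess s = sum₂ λ u v → excess (adj G u v) (s u) (s v)

    weight : Fin n → Fin n → ℤ
    weight u v = + 50 * indicator (adj G u v)

    idleExcess : ℤ
    idleExcess = sum₂ λ u v → weight u v - + 29

  -- Without loops the quadratic part has no diagonal, and each unordered pair occurs in both
  -- orders, hence the factor 2. Only the energy depends on `s`, so `rounding` applies.
  totalExcess-energy : ∀ s → totalExcess s ≡ idleExcess + + 2 * energy weight (λ _ → 0ℤ) s
  totalExcess-energy s = begin
    totalExcess s
      ≡⟨ sum₂-cong (λ u v → expand (indicator (adj G u v)) (⟦ s u ⟧ * ⟦ s v ⟧)) ⟩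
    sum₂ (λ u v → (weight u v - + 29) + interaction u v)
      ≡⟨ sum₂-+ (λ u v → weight u v - + 29) interaction ⟩
    idleExcess + sum₂ interaction
      ≡⟨ cong (_+_ idleExcess) (sum₂-pairSum interaction interaction-sym interaction-diag) ⟩
    idleExcess + + 2 * pairSum interaction
      ≡⟨ cong (λ e → idleExcess + + 2 * e) (energy-noField weight s) ⟨
    idleExcess + + 2 * energy weight (λ _ → 0ℤ) s ∎
    where
    open ≡-Reasoning
    interaction : Fin n → Fin n → ℤ
    interaction u v = weight u v * (⟦ s u ⟧ * ⟦ s v ⟧)
    expand : ∀ a m → + 50 * a * (1ℤ + m) - + 29 ≡ (+ 50 * a - + 29) + + 50 * a * m
    expand = solve-∀
    interaction-sym : ∀ u v → interaction u v ≡ interaction v u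
    interaction-sym u v = cong₂ (λ a m → + 50 * indicator a * m) (Graph.sym G u v) (*-comm ⟦ s u ⟧ ⟦ s v ⟧)
    interaction-diag : ∀ u → interaction u u ≡ 0ℤ
    interaction-diag u = cong (λ a → + 50 * indicator a * (⟦ s u ⟧ * ⟦ s u ⟧)) (Graph.irrefl G u)

  totalExcess-side : ∀ c → + (200 ℕ.* size (monochromatic G c)) - + (29 ℕ.* (n ℕ.* n)) ≤ totalExcess (side ∘ lookup c)
  totalExcess-side c = begin
    + (200 ℕ.* size F) - + (29 ℕ.* (n ℕ.* n))
      ≡⟨ cong₂ (λ p q → p - q) (pos-* 200 (size F)) (trans (pos-* 29 (n ℕ.* n)) (cong (_*_ (+ 29)) (pos-* n n))) ⟩
    + 200 * + size F - + 29 * (+ n * + n)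
      ≡⟨ regroup (+ size F) (+ n) ⟩
    + 100 * (+ 2 * + size F) + + n * (+ n * - + 29)
      ≤⟨ +-monoˡ-≤ (+ n * (+ n * - + 29)) (*-monoˡ-≤-nonNeg (+ 100) (double-size F)) ⟩
    + 100 * sum₂ inside + + n * (+ n * - + 29)
      ≡⟨ cong₂ _+_ (sum₂-*ˡ (+ 100) inside) (sum₂-const n (- + 29)) ⟨
    sum₂ (λ u v → + 100 * inside u v) + sum₂ {n} (λ u v → - + 29)
      ≡⟨ sum₂-+ (λ u v → + 100 * inside u v) (λ _ _ → - + 29) ⟨
    sum₂ (λ u v → + 100 * inside u v + - + 29)
      ≡⟨ sum₂-cong (λ u v → excess-side (adj G u v) (lookup c u) (lookup c v)) ⟨
    totalExcess (side ∘ lookup c) ∎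
    where
    open ≤-Reasoning
    F : EdgeSubset G
    F = monochromatic G c
    inside : Fin n → Fin n → ℤ
    inside u v = indicator (mem F u v)
    regroup : ∀ f m → + 200 * f - + 29 * (m * m) ≡ + 100 * (+ 2 * f) + m * (m * - + 29)
    regroup = solve-∀

  -- Rounding `s` to a colouring does not raise the total excess, so a lower bound over colourings
  -- carries over to all spin assignments.
  totalExcess-nonneg : (∀ c → 29 ℕ.* (n ℕ.* n) ℕ.≤ 200 ℕ.* size (monochromatic G c)) → ∀ s → 0ℤ ≤ totalExcess s
  totalExcess-nonneg manyMonochromatic s with rounding weight (λ _ → 0ℤ) s
  ... | c , smaller = begin
    0ℤ
      ≤⟨ i≤j⇒0≤j-i (+≤+ (manyMonochromatic c)) ⟩
    + (200 ℕ.* size (monochromatic G c)) - + (29 ℕ.* (n ℕ.* n))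
      ≤⟨ totalExcess-side c ⟩
    totalExcess (side ∘ lookup c)
      ≡⟨ totalExcess-energy (side ∘ lookup c) ⟩
    idleExcess + + 2 * energy weight (λ _ → 0ℤ) (side ∘ lookup c)
      ≤⟨ +-monoʳ-≤ idleExcess (*-monoˡ-≤-nonNeg (+ 2) smaller) ⟩
    idleExcess + + 2 * energy weight (λ _ → 0ℤ) s
      ≡⟨ totalExcess-energy s ⟨
    totalExcess s ∎
    where open ≤-Reasoning

theorem4p8 : (n : ℕ) (G : Graph n) → K5-free G → τB-scaled≤ G (29 ℕ.* (n ℕ.* n)) 200
-- The empty graph has no 5-tuples, so the sign argument does not reach it; here both sides are 0.
theorem4p8 zero    G K5-free-G = monochromatic G [] , monochromatic-bipartite G [] , z≤n
theorem4p8 (suc n) G K5-free-G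
  -- Colourings are finitely many, so a good one is found by search, or else all of them violate the
  -- bound.
  with anySubset? (λ c → 200 ℕ.* size (monochromatic G c) ℕₚ.≤? 29 ℕ.* (suc n ℕ.* suc n))
... | yes (c , few) = monochromatic G c , monochromatic-bipartite G c , few
... | no ¬few = contradiction
  (totalExcess-nonneg G λ c → ℕₚ.<⇒≤ (ℕₚ.≰⇒> λ few → ¬few (c , few)))
  (excess-somewhere-negative G K5-free-G)
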